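{- Let $C_3$ be the triangle graph, let $\Bbbk$ be a field, and let $H_{C_3}(u,s)$ be the bigraded Hilbert polynomial of the associated graded algebra of the squarefree edge algebra of $C_3$ with respect to the rank filtration. Then $$H_{C_3}(u,s)=1+3us+3u^2s^2+u^2s^3.$$ Moreover, the Negami polynomial of $C_3$ satisfies $$f(C_3;t,x,y)=t^3y^3\,H_{C_3}(t^{ -1},x/y).$$
   Context: The Negami polynomial $f(G)=f(G;t,x,y)$ of a finite graph is the polynomial determined by $f(\overline K_n)=t^n$, where $\overline K_n$ is the edgeless graph on $n$ vertices, and $f(G)=x f(G/e)+y f(G-e)$ for any edge $e$, where $G/e$ and $G-e$ are the contraction and deletion of $e$ (contraction keeps any resulting loops and multiple edges; contracting a loop means deleting it). Let $G=C_3$ with edge set $E=\{e_1,e_2,e_3\}$. The squarefree edge algebra is $B_G=\Bbbk[z_1,z_2,z_3]/(z_1^2,z_2^2,z_3^2)$. For $A\subseteq E$ write $z_A=\prod_{e_i\in A}z_i$, and let $\rho(A)$ be the rank of $A$ in the graphic matroid of $G$, i.e. $\rho(A)=|V(G)|-k(A)$ with $k(A)$ the number of connected components of the spanning subgraph $(V(G),A)$. The rank filtration is $F_pB_G=\operatorname{span}_{\Bbbk}\{z_A:\rho(A)\le p\}$ for $p\ge 0$, with $F_{ -1}B_G=0$. It is multiplicative, and the associated graded algebra is $\operatorname{gr}_F B_G=\bigoplus_{p\ge 0}F_pB_G/F_{p-1}B_G$. It also retains the ordinary polynomial degree (where $z_A$ has degree $|A|$), so it is bigraded, the class of $z_A$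 having bidegree $(\rho(A),|A|)$. Its bigraded Hilbert polynomial is $H_G(u,s)=\sum_{p,d}\dim_{\Bbbk}(\operatorname{gr}_F B_G)_{p,d}\,u^ps^d$. -}

module Defs where

open import Level using (_⊔_)
open import Algebra.Apartness using (HeytingField; module HeytingField; module HeytingCommutativeRing)
open import Algebra.Bundles using (Ring; CommutativeRing; CommutativeMonoid)
open import Algebra.Module.Bundles using (LeftModule)
import Algebra.Definitions.RawMonoid as RawMonoidOps
import Algebra.Properties.AbelianGroup as AbelianGroupProps
import Algebra.Properties.CommutativeSemigroup as CommSemigroupProps
import Algebra.Properties.Ring as RingProps
import Algebra.Module.Properties.LeftModule as LeftModuleProps
open import Data.Bool.Base using (Bool; true; false; if_then_else_)
open import Data.Fin.Base using (Fin; zero; suc; punchIn; punchOut)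
open import Data.Fin.Patterns using (0F; 1F; 2F)
open import Data.Fin.Properties using (_≟_; punchOut-cong; punchOut-injective; punchOut-punchIn; punchInᵢ≢i; injective⇒≤)
open import Data.Fin.Subset using (Subset; ∣_∣)
open import Data.Integer.Base as ℤ using (ℤ; +_; -[1+_])
import Data.Integer.Properties as ℤₚ
open import Data.List.Base as List using (List; []; _∷_; _++_)
import Data.List.Properties as Listₚ
open import Data.List.Membership.Propositional using (_∈_)
open import Data.List.Relation.Unary.Any using (here; there)
open import Data.List.Relation.Binary.Permutation.Propositional as Perm
  using (_↭_; ↭-refl; prep; swap; refl)
import Data.List.Relation.Binary.Permutation.Propositional.Properties as Permₚ
open import Data.Nat.Base as ℕ using (ℕ; zero; suc; _∸_; _≤_)
import Data.Nat.Properties as ℕₚ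
open import Data.Product.Base using (Σ; ∃; _×_; _,_; proj₁; proj₂; map)
open import Data.Sum.Base using (_⊎_; inj₁; inj₂)
open import Data.Vec.Base as Vec using (Vec; []; _∷_; lookup; removeAt; zipWith; replicate)
import Data.Vec.Properties as Vecₚ
open import Function.Base using (_∘_; id; case_of_)
open import Relation.Binary.Core using (Rel)
open import Relation.Binary.Definitions using (DecidableEquality)
open import Relation.Binary.Construct.Closure.Equivalence as EqClosure using (EqClosure)
open import Relation.Binary.Construct.Closure.ReflexiveTransitive using (ε; _◅_)
open import Relation.Binary.Construct.Closure.Symmetric using (fwd; bwd)
open import Relation.Binary.PropositionalEquality
  using (_≡_; _≢_; refl; sym; trans; cong; cong₂; module ≡-Reasoning)
open import Relation.Nullary.Decidable using (does; yes; no)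
open import Relation.Nullary.Negation using (contradiction)

------------------------------------------------------------------------
-- Submodules, quotients and dimension

module Modules {r ℓ} (R : Ring r ℓ) where
  open Ring R using (Carrier; _≈_; 0#)

  record Submodule {m ℓm} (M : LeftModule R m ℓm) s
         : Set (r ⊔ m ⊔ ℓm ⊔ Level.suc s) where
    open LeftModule M
    field
      Member : Carrierᴹ → Set s
      resp   : ∀ {v w} → v ≈ᴹ w → Member v → Member w
      zero∈  : Member 0ᴹ
      add∈   : ∀ {v w} → Member v → Member w → Member (v +ᴹ w)
      scale∈ : ∀ c {v} → Member v → Member (c *ₗ v)

  open Submodule public using (Member)

  module _ {m ℓm} (M : LeftModule R m ℓm) where
    open LeftModule M

    data Span {s} (S : Carrierᴹ → Set s) : Carrierᴹ → Set (r ⊔ m ⊔ ℓm ⊔ s) where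
      gen   : ∀ {v} → S v → Span S v
      resp  : ∀ {v w} → v ≈ᴹ w → Span S v → Span S w
      zero∈ : Span S 0ᴹ
      add∈  : ∀ {v w} → Span S v → Span S w → Span S (v +ᴹ w)
      scale : ∀ c {v} → Span S v → Span S (c *ₗ v)

    span : ∀ {s} → (Carrierᴹ → Set s) → Submodule M (r ⊔ m ⊔ ℓm ⊔ s)
    span S = record
      { Member = Span S ; resp = resp ; zero∈ = zero∈ ; add∈ = add∈ ; scale∈ = scale }

    zeroSubmodule : Submodule M ℓm
    zeroSubmodule = record
      { Member = _≈ᴹ 0ᴹ
      ; resp   = λ v≈w v≈0 → ≈ᴹ-trans (≈ᴹ-sym v≈w) v≈0
      ; zero∈  = ≈ᴹ-refl
      ; add∈   = λ v≈0 w≈0 → ≈ᴹ-trans (+ᴹ-cong v≈0 w≈0) (+ᴹ-identityˡ 0ᴹ)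
      ; scale∈ = λ c v≈0 → ≈ᴹ-trans (*ₗ-cong (Ring.refl R) v≈0) (*ₗ-zeroʳ c)
      }

    _∩_ : ∀ {s t} → Submodule M s → Submodule M t → Submodule M (s ⊔ t)
    U ∩ W = record
      { Member = λ v → Member U v × Member W v
      ; resp   = λ eq (p , q) → U.resp eq p , W.resp eq q
      ; zero∈  = U.zero∈ , W.zero∈
      ; add∈   = λ (p , q) (p′ , q′) → U.add∈ p p′ , W.add∈ q q′
      ; scale∈ = λ c (p , q) → U.scale∈ c p , W.scale∈ c q
      }
      where
      module U = Submodule U
      module W = Submodule W

    HasDimension : ℕ → Set (r ⊔ ℓ ⊔ m ⊔ ℓm)
    HasDimension n = Σ (Fin n → Carrierᴹ) λ e →
        (∀ v → Σ (Fin n → Carrier) λ c → v ≈ᴹ ∑ (λ i → c i *ₗ e i))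
      × (∀ (c : Fin n → Carrier) → ∑ (λ i → c i *ₗ e i) ≈ᴹ 0ᴹ → ∀ i → c i ≈ 0#)
      where open RawMonoidOps +ᴹ-rawMonoid using () renaming (sum to ∑)

    private
      open Ring R using (1#) renaming (-_ to neg)
      open AbelianGroupProps +ᴹ-abelianGroup
        using (⁻¹-involutive; ⁻¹-∙-comm)
      open LeftModuleProps M using (inverseˡ-uniqueᴹ)
      open CommSemigroupProps (CommutativeMonoid.commutativeSemigroup +ᴹ-commutativeMonoid)
        using (interchange)
      module ≈ = LeftModule M
      open import Relation.Binary.Reasoning.Setoid ≈.≈ᴹ-setoid

      neg-scale : ∀ c v → neg c *ₗ v ≈ᴹ -ᴹ (c *ₗ v)
      neg-scale c v = inverseˡ-uniqueᴹ _ _ (begin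
        neg c *ₗ v +ᴹ c *ₗ v   ≈⟨ *ₗ-distribʳ v (neg c) c ⟨
        (neg c + c) *ₗ v       ≈⟨ *ₗ-cong (Ring.-‿inverseˡ R c) ≈ᴹ-refl ⟩
        0# *ₗ v                ≈⟨ *ₗ-zeroˡ v ⟩
        0ᴹ                     ∎)
        where open Ring R using (_+_)

      scale-neg : ∀ c v → c *ₗ (-ᴹ v) ≈ᴹ -ᴹ (c *ₗ v)
      scale-neg c v = inverseˡ-uniqueᴹ _ _ (begin
        c *ₗ (-ᴹ v) +ᴹ c *ₗ v  ≈⟨ *ₗ-distribˡ c (-ᴹ v) v ⟨
        c *ₗ (-ᴹ v +ᴹ v)       ≈⟨ *ₗ-cong (Ring.refl R) (-ᴹ‿inverseˡ v) ⟩
        c *ₗ 0ᴹ                ≈⟨ *ₗ-zeroʳ c ⟩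
        0ᴹ                     ∎)

      minus : ∀ {s} (U : Submodule M s) {v} → Member U v → Member U (-ᴹ v)
      minus U {v} p = Submodule.resp U
        (≈ᴹ-trans (neg-scale 1# v) (-ᴹ‿cong (*ₗ-identityˡ v)))
        (Submodule.scale∈ U (neg 1#) p)

    asModule : ∀ {s} → Submodule M s → LeftModule R (m ⊔ s) ℓm
    asModule U = record
      { Carrierᴹ = Σ Carrierᴹ (Member U)
      ; _≈ᴹ_     = λ v w → proj₁ v ≈ᴹ proj₁ w
      ; _+ᴹ_     = λ (v , p) (w , q) → v +ᴹ w , U.add∈ p q
      ; _*ₗ_     = λ c (v , p) → c *ₗ v , U.scale∈ c p
      ; 0ᴹ       = 0ᴹ , U.zero∈
      ; -ᴹ_      = λ (v , p) → -ᴹ v , minus U p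
      ; isLeftModule = record
        { isLeftSemimodule = record
          { +ᴹ-isCommutativeMonoid = record
            { isMonoid = record
              { isSemigroup = record
                { isMagma = record
                  { isEquivalence = record
                    { refl = ≈ᴹ-refl ; sym = ≈ᴹ-sym ; trans = ≈ᴹ-trans }
                  ; ∙-cong = +ᴹ-cong }
                ; assoc = λ u v w → +ᴹ-assoc _ _ _ }
              ; identity = (λ v → +ᴹ-identityˡ _) , (λ v → +ᴹ-identityʳ _) }
            ; comm = λ v w → +ᴹ-comm _ _ }
          ; isPreleftSemimodule = record
            { *ₗ-cong      = *ₗ-cong
            ; *ₗ-zeroˡ     = λ v → *ₗ-zeroˡ _
            ; *ₗ-distribʳ  = λ v c d → *ₗ-distribʳ _ c d
            ; *ₗ-identityˡ = λ v → *ₗ-identityˡ _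
            ; *ₗ-assoc     = λ c d v → *ₗ-assoc c d _
            ; *ₗ-zeroʳ     = *ₗ-zeroʳ
            ; *ₗ-distribˡ  = λ c v w → *ₗ-distribˡ c _ _ } }
        ; -ᴹ‿cong    = -ᴹ‿cong
        ; -ᴹ‿inverse = (λ v → -ᴹ‿inverseˡ _) , (λ v → -ᴹ‿inverseʳ _) } }
      where module U = Submodule U

    restrict : ∀ {s t} (U : Submodule M s) → Submodule M t → Submodule (asModule U) t
    restrict U W = record
      { Member = Member W ∘ proj₁
      ; resp   = W.resp
      ; zero∈  = W.zero∈
      ; add∈   = W.add∈
      ; scale∈ = λ c → W.scale∈ c }
      where module W = Submodule W

    infixl 7 _/_
    _/_ : ∀ {s} → Submodule M s → LeftModule R m s
    _/_ N = record
      { Carrierᴹ = Carrierᴹ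
      ; _≈ᴹ_     = _~_
      ; _+ᴹ_     = _+ᴹ_
      ; _*ₗ_     = _*ₗ_
      ; 0ᴹ       = 0ᴹ
      ; -ᴹ_      = -ᴹ_
      ; isLeftModule = record
        { isLeftSemimodule = record
          { +ᴹ-isCommutativeMonoid = record
            { isMonoid = record
              { isSemigroup = record
                { isMagma = record
                  { isEquivalence = record
                    { refl = ≈⇒~ ≈ᴹ-refl ; sym = ~-sym ; trans = ~-trans }
                  ; ∙-cong = ~-+ }
                ; assoc = λ u v w → ≈⇒~ (+ᴹ-assoc u v w) }
              ; identity = (λ v → ≈⇒~ (+ᴹ-identityˡ v)) , (λ v → ≈⇒~ (+ᴹ-identityʳ v)) }
            ; comm = λ v w → ≈⇒~ (+ᴹ-comm v w) }
          ; isPreleftSemimodule = record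
            { *ₗ-cong      = ~-scale
            ; *ₗ-zeroˡ     = λ v → ≈⇒~ (*ₗ-zeroˡ v)
            ; *ₗ-distribʳ  = λ v c d → ≈⇒~ (*ₗ-distribʳ v c d)
            ; *ₗ-identityˡ = λ v → ≈⇒~ (*ₗ-identityˡ v)
            ; *ₗ-assoc     = λ c d v → ≈⇒~ (*ₗ-assoc c d v)
            ; *ₗ-zeroʳ     = λ c → ≈⇒~ (*ₗ-zeroʳ c)
            ; *ₗ-distribˡ  = λ c v w → ≈⇒~ (*ₗ-distribˡ c v w) } }
        ; -ᴹ‿cong    = ~-neg
        ; -ᴹ‿inverse = (λ v → ≈⇒~ (-ᴹ‿inverseˡ v)) , (λ v → ≈⇒~ (-ᴹ‿inverseʳ v)) } }
      where
      module N = Submodule N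

      _~_ : Rel Carrierᴹ _
      v ~ w = Member N (v +ᴹ (-ᴹ w))

      ≈⇒~ : ∀ {v w} → v ≈ᴹ w → v ~ w
      ≈⇒~ {v} {w} eq = N.resp
        (≈ᴹ-trans (≈ᴹ-sym (-ᴹ‿inverseʳ w)) (+ᴹ-cong (≈ᴹ-sym eq) ≈ᴹ-refl)) N.zero∈

      ~-neg : ∀ {v w} → v ~ w → (-ᴹ v) ~ (-ᴹ w)
      ~-neg {v} {w} p = N.resp (≈ᴹ-sym (⁻¹-∙-comm v (-ᴹ w))) (minus N p)

      ~-sym : ∀ {v w} → v ~ w → w ~ v
      ~-sym {v} {w} p = N.resp (begin
        -ᴹ (v +ᴹ -ᴹ w)       ≈⟨ ⁻¹-∙-comm v (-ᴹ w) ⟨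
        -ᴹ v +ᴹ -ᴹ (-ᴹ w)    ≈⟨ +ᴹ-cong ≈ᴹ-refl (⁻¹-involutive w) ⟩
        -ᴹ v +ᴹ w            ≈⟨ +ᴹ-comm _ _ ⟩
        w +ᴹ -ᴹ v            ∎) (minus N p)

      ~-trans : ∀ {u v w} → u ~ v → v ~ w → u ~ w
      ~-trans {u} {v} {w} p q = N.resp (begin
        (u +ᴹ -ᴹ v) +ᴹ (v +ᴹ -ᴹ w)  ≈⟨ +ᴹ-assoc u (-ᴹ v) _ ⟩
        u +ᴹ (-ᴹ v +ᴹ (v +ᴹ -ᴹ w))  ≈⟨ +ᴹ-cong ≈ᴹ-refl (+ᴹ-assoc (-ᴹ v) v (-ᴹ w)) ⟨
        u +ᴹ ((-ᴹ v +ᴹ v) +ᴹ -ᴹ w)  ≈⟨ +ᴹ-cong ≈ᴹ-refl (+ᴹ-cong (-ᴹ‿inverseˡ v) ≈ᴹ-refl) ⟩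
        u +ᴹ (0ᴹ +ᴹ -ᴹ w)           ≈⟨ +ᴹ-cong ≈ᴹ-refl (+ᴹ-identityˡ _) ⟩
        u +ᴹ -ᴹ w                   ∎) (N.add∈ p q)

      ~-+ : ∀ {u v w x} → u ~ v → w ~ x → (u +ᴹ w) ~ (v +ᴹ x)
      ~-+ {u} {v} {w} {x} p q = N.resp (begin
        (u +ᴹ -ᴹ v) +ᴹ (w +ᴹ -ᴹ x)  ≈⟨ interchange u (-ᴹ v) w (-ᴹ x) ⟩
        (u +ᴹ w) +ᴹ (-ᴹ v +ᴹ -ᴹ x)  ≈⟨ +ᴹ-cong ≈ᴹ-refl (⁻¹-∙-comm v x) ⟩
        (u +ᴹ w) +ᴹ -ᴹ (v +ᴹ x)     ∎) (N.add∈ p q)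

      ~-scale : ∀ {c d v w} → c ≈ d → v ~ w → (c *ₗ v) ~ (d *ₗ w)
      ~-scale {c} {d} {v} {w} eq p = N.resp (begin
        c *ₗ (v +ᴹ -ᴹ w)             ≈⟨ *ₗ-distribˡ c v (-ᴹ w) ⟩
        c *ₗ v +ᴹ c *ₗ (-ᴹ w)        ≈⟨ +ᴹ-cong ≈ᴹ-refl (scale-neg c w) ⟩
        c *ₗ v +ᴹ -ᴹ (c *ₗ w)        ≈⟨ +ᴹ-cong ≈ᴹ-refl (-ᴹ‿cong (*ₗ-cong eq ≈ᴹ-refl)) ⟩
        c *ₗ v +ᴹ -ᴹ (d *ₗ w)        ∎) (N.scale∈ c p)

------------------------------------------------------------------------
-- Polynomials and Laurent polynomials

record Exponents (E : Set) : Set where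
  field
    _⊕_     : E → E → E
    unit    : E
    _≟ᴱ_    : DecidableEquality E

instance
  ℕ-exponents : ∀ {n} → Exponents (Vec ℕ n)
  ℕ-exponents = record
    { _⊕_ = zipWith ℕ._+_ ; unit = replicate _ 0 ; _≟ᴱ_ = Vecₚ.≡-dec ℕₚ._≟_ }

  ℤ-exponents : ∀ {n} → Exponents (Vec ℤ n)
  ℤ-exponents = record
    { _⊕_ = zipWith ℤ._+_ ; unit = replicate _ (+ 0) ; _≟ᴱ_ = Vecₚ.≡-dec ℤₚ._≟_ }

-- A polynomial is a finite list of terms (coefficient , exponent), in which an
-- exponent may be repeated; two polynomials are equal when all their
-- coefficients agree.  Polynomials in n variables are Poly (Vec ℕ n), and
-- Laurent polynomials in n variables are Poly (Vec ℤ n).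
module Polynomials {r ℓ} (R : CommutativeRing r ℓ) where
  private module R = CommutativeRing R
  open Exponents ⦃ ... ⦄

  Poly : Set → Set r
  Poly E = List (R.Carrier × E)

  private variable
    E : Set

  module _ {E : Set} ⦃ _ : Exponents E ⦄ where

    coeff : Poly E → E → R.Carrier
    coeff []            e = R.0#
    coeff ((c , d) ∷ p) e = (if does (d ≟ᴱ e) then c else R.0#) R.+ coeff p e

    infix 4 _≈_
    _≈_ : Poly E → Poly E → Set ℓ
    p ≈ q = ∀ e → coeff p e R.≈ coeff q e

    const : R.Carrier → Poly E
    const c = (c , unit) ∷ []

  infixl 6 _+_
  _+_ : Poly E → Poly E → Poly E
  _+_ = _++_

  infixr 7 _·_
  _·_ : R.Carrier → Poly E → Poly E
  c · p = List.map (λ (d , e) → c R.* d , e) p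

  monomial : E → Poly E
  monomial e = (R.1# , e) ∷ []

  module _ {E : Set} ⦃ _ : Exponents E ⦄ where

    infixl 7 _*_
    _*_ : Poly E → Poly E → Poly E
    _*_ = List.cartesianProductWith λ (c , d) (c′ , d′) → c R.* c′ , d ⊕ d′

    infixr 8 _^_
    _^_ : Poly E → ℕ → Poly E
    p ^ zero  = const R.1#
    p ^ suc n = p * p ^ n

    infix 9 _⟦_⟧
    -- p ⟦ v ⟧ is the result of substituting v₁, …, vₙ for the variables of p.
    _⟦_⟧ : ∀ {n} → Poly (Vec ℕ n) → Vec (Poly E) n → Poly E
    _⟦_⟧ {n} p v = List.foldr _+_ [] (List.map term p)
      where
      term : R.Carrier × Vec ℕ n → Poly E
      term (c , e) = const c * Vec.foldr _ _*_ (const R.1#) (zipWith _^_ v e)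

    private
      open RingProps R.ring using (-1*x≈-x)
      open import Relation.Binary.Reasoning.Setoid R.setoid

      coeff-+ : ∀ (p q : Poly E) e → coeff (p + q) e R.≈ coeff p e R.+ coeff q e
      coeff-+ []      q e = R.sym (R.+-identityˡ _)
      coeff-+ (_ ∷ p) q e = R.trans (R.+-congˡ (coeff-+ p q e)) (R.sym (R.+-assoc _ _ _))

      if-scale : ∀ (x : Bool) c d →
        (if x then c R.* d else R.0#) R.≈ c R.* (if x then d else R.0#)
      if-scale false c d = R.sym (R.zeroʳ c)
      if-scale true  c d = R.refl

      coeff-· : ∀ c (p : Poly E) e → coeff (c · p) e R.≈ c R.* coeff p e
      coeff-· c []            e = R.sym (R.zeroʳ c)
      coeff-· c ((d , f) ∷ p) e = R.trans
        (R.+-cong (if-scale (does (f ≟ᴱ e)) c d) (coeff-· c p e))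
        (R.sym (R.distribˡ c _ _))

      ext : ∀ (p q : Poly E) (f g : E → R.Carrier) →
            (∀ e → coeff p e R.≈ f e) → (∀ e → coeff q e R.≈ g e) →
            (∀ e → f e R.≈ g e) → p ≈ q
      ext p q f g p≈ q≈ eq e = R.trans (p≈ e) (R.trans (eq e) (R.sym (q≈ e)))

      inverse : ∀ (p : Poly E) e → coeff ((R.- R.1#) · p + p) e R.≈ R.0#
      inverse p e = begin
        coeff ((R.- R.1#) · p + p) e                 ≈⟨ coeff-+ ((R.- R.1#) · p) p e ⟩
        coeff ((R.- R.1#) · p) e R.+ coeff p e       ≈⟨ R.+-congʳ (coeff-· (R.- R.1#) p e) ⟩
        (R.- R.1#) R.* coeff p e R.+ coeff p e       ≈⟨ R.+-congʳ (-1*x≈-x _) ⟩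
        (R.- coeff p e) R.+ coeff p e                ≈⟨ R.-‿inverseˡ _ ⟩
        R.0#                                         ∎

      +-cong : ∀ {p p′ q q′ : Poly E} → p ≈ p′ → q ≈ q′ → p + q ≈ p′ + q′
      +-cong {p} {p′} {q} {q′} eq eq′ = ext (p + q) (p′ + q′) _ _ (coeff-+ p q) (coeff-+ p′ q′)
        λ e → R.+-cong (eq e) (eq′ e)

      ·-cong : ∀ {c d} {p q : Poly E} → c R.≈ d → p ≈ q → c · p ≈ d · q
      ·-cong {c} {d} {p} {q} eq eq′ = ext (c · p) (d · q) _ _ (coeff-· c p) (coeff-· d q)
        λ e → R.*-cong eq (eq′ e)

      +-comm : ∀ (p q : Poly E) → p + q ≈ q + p
      +-comm p q = ext (p + q) (q + p) _ _ (coeff-+ p q) (coeff-+ q p) λ e → R.+-comm _ _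

      +-assoc : ∀ (p q s : Poly E) → (p + q) + s ≈ p + (q + s)
      +-assoc p q s e = R.reflexive (cong (λ l → coeff l e) (Listₚ.++-assoc p q s))

    polyModule : LeftModule R.ring r ℓ
    polyModule = record
      { Carrierᴹ = Poly E
      ; _≈ᴹ_     = _≈_
      ; _+ᴹ_     = _+_
      ; _*ₗ_     = _·_
      ; 0ᴹ       = []
      ; -ᴹ_      = (R.- R.1#) ·_
      ; isLeftModule = record
        { isLeftSemimodule = record
          { +ᴹ-isCommutativeMonoid = record
            { isMonoid = record
              { isSemigroup = record
                { isMagma = record
                  { isEquivalence = record
                    { refl  = λ e → R.refl
                    ; sym   = λ eq e → R.sym (eq e)
                    ; trans = λ eq eq′ e → R.trans (eq e) (eq′ e) }
                  ; ∙-cong = λ {p} {p′} {q} {q′} → +-cong {p} {p′} {q} {q′} }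
                ; assoc = +-assoc }
              ; identity = (λ p e → R.refl)
                         , (λ p e → R.trans (coeff-+ p [] e) (R.+-identityʳ _)) }
            ; comm = +-comm }
          ; isPreleftSemimodule = record
            { *ₗ-cong      = λ {c} {d} {p} {q} → ·-cong {c} {d} {p} {q}
            ; *ₗ-zeroˡ     = λ p e → R.trans (coeff-· R.0# p e) (R.zeroˡ _)
            ; *ₗ-distribʳ  = λ p c d → ext ((c R.+ d) · p) (c · p + d · p) _ _ (coeff-· (c R.+ d) p)
                (λ e → R.trans (coeff-+ (c · p) (d · p) e)
                               (R.+-cong (coeff-· c p e) (coeff-· d p e)))
                (λ e → R.distribʳ _ _ _)
            ; *ₗ-identityˡ = λ p e → R.trans (coeff-· R.1# p e) (R.*-identityˡ _)
            ; *ₗ-assoc     = λ c d p → ext ((c R.* d) · p) (c · (d · p)) _ _ (coeff-· (c R.* d) p)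
                (λ e → R.trans (coeff-· c (d · p) e) (R.*-congˡ (coeff-· d p e)))
                (λ e → R.*-assoc _ _ _)
            ; *ₗ-zeroʳ     = λ c e → R.refl
            ; *ₗ-distribˡ  = λ c p q → ext (c · (p + q)) (c · p + c · q) _ _
                (λ e → R.trans (coeff-· c (p + q) e) (R.*-congˡ (coeff-+ p q e)))
                (λ e → R.trans (coeff-+ (c · p) (c · q) e)
                               (R.+-cong (coeff-· c p e) (coeff-· c q e)))
                (λ e → R.distribˡ _ _ _) } }
        ; -ᴹ‿cong    = λ {p} {q} eq → ·-cong {R.- R.1#} {_} {p} {q} R.refl eq
        ; -ᴹ‿inverse = inverse
                     , (λ p e → R.trans (+-comm p ((R.- R.1#) · p) e) (inverse p e)) } }

    ↭⇒≈ : {p q : Poly E} → p ↭ q → p ≈ q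
    ↭⇒≈ refl           e = R.refl
    ↭⇒≈ (prep x p↭q)   e = R.+-congˡ (↭⇒≈ p↭q e)
    ↭⇒≈ (swap x y p↭q) e = R.trans (R.+-congˡ (R.+-congˡ (↭⇒≈ p↭q e)))
      (CommSemigroupProps.x∙yz≈y∙xz R.+-commutativeSemigroup _ _ _)
    ↭⇒≈ (Perm.trans s t) e = R.trans (↭⇒≈ s e) (↭⇒≈ t e)

------------------------------------------------------------------------
-- Multigraphs, connected components, deletion and contraction

-- A multigraph (loops and parallel edges allowed) with vertex set Fin n and
-- edge set Fin m, given by the endpoints of each edge.
Graph : ℕ → ℕ → Set
Graph n m = Vec (Fin n × Fin n) m

private variable
  n k N : ℕ
  A : Set

Connected : List (Fin n × Fin n) → Rel (Fin n) _
Connected es = EqClosure (λ u v → (u , v) ∈ es)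

record Components (es : List (Fin n × Fin n)) : Set where
  field
    count      : ℕ
    class      : Fin n → Fin count
    surjective : ∀ i → ∃ λ u → class u ≡ i
    sound      : ∀ {u v} → Connected es u v → class u ≡ class v
    complete   : ∀ {u v} → class u ≡ class v → Connected es u v

private
  -- Identify j with i.
  merge : {i j : Fin (suc n)} → i ≢ j → Fin (suc n) → Fin n
  merge {i = i} {j} i≢j v with j ≟ v
  ... | yes _  = punchOut (i≢j ∘ sym)
  ... | no j≢v = punchOut j≢v

  merge-eq : {i j : Fin (suc n)} (i≢j : i ≢ j) → merge i≢j i ≡ merge i≢j j
  merge-eq {i = i} {j} i≢j with j ≟ i | j ≟ j
  ... | yes p | _      = contradiction (sym p) i≢j
  ... | no _  | yes _  = punchOut-cong j refl
  ... | no _  | no j≢j = contradiction refl j≢j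

  merge-surj : {i j : Fin (suc n)} (i≢j : i ≢ j) → ∀ x → ∃ λ v → merge i≢j v ≡ x
  merge-surj {j = j} i≢j x = punchIn j x , eq
    where
    eq : merge i≢j (punchIn j x) ≡ x
    eq with j ≟ punchIn j x
    ... | yes p = contradiction (sym p) (punchInᵢ≢i j x)
    ... | no _  = trans (punchOut-cong j refl) (punchOut-punchIn j)

  merge-kernel : {i j : Fin (suc n)} (i≢j : i ≢ j) → ∀ {u v} →
    merge i≢j u ≡ merge i≢j v → u ≡ v ⊎ (u ≡ i × v ≡ j) ⊎ (u ≡ j × v ≡ i)
  merge-kernel {j = j} i≢j {u} {v} eq with j ≟ u | j ≟ v
  ... | yes p | yes q = inj₁ (trans (sym p) q)
  ... | yes p | no j≢v = inj₂ (inj₂ (sym p , sym (punchOut-injective (i≢j ∘ sym) j≢v eq)))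
  ... | no j≢u | yes q = inj₂ (inj₁ (punchOut-injective j≢u (i≢j ∘ sym) eq , sym q))
  ... | no j≢u | no j≢v = inj₁ (punchOut-injective j≢u j≢v eq)

  fold : ∀ {es : List (Fin n × Fin n)} (g : Fin n → A) →
         (∀ {u v} → (u , v) ∈ es → g u ≡ g v) →
         ∀ {u v} → Connected es u v → g u ≡ g v
  fold g eq ε             = refl
  fold g eq (fwd uv ◅ p)  = trans (eq uv) (fold g eq p)
  fold g eq (bwd vu ◅ p)  = trans (sym (eq vu)) (fold g eq p)

  weaken : ∀ {e} {es : List (Fin n × Fin n)} {u v} → Connected es u v → Connected (e ∷ es) u v
  weaken = EqClosure.map there

  addEdge : ∀ {es : List (Fin n × Fin n)} (e : Fin n × Fin n) → Components es → Components (e ∷ es)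
  addEdge {n} {es} (a , b) C = extend (Components.count C) (Components.class C)
      (Components.surjective C) (Components.sound C) (Components.complete C)
    where
    extend : ∀ k (cl : Fin n → Fin k) → (∀ i → ∃ λ u → cl u ≡ i) →
             (∀ {u v} → Connected es u v → cl u ≡ cl v) →
             (∀ {u v} → cl u ≡ cl v → Connected es u v) →
             Components ((a , b) ∷ es)
    extend zero    cl _ _ _ with () ← cl a
    extend (suc k) cl surj snd cpl with cl a ≟ cl b
    ... | yes a~b = record
      { count = suc k ; class = cl ; surjective = surj
      ; sound = fold cl λ { (here refl) → a~b
                          ; (there uv)  → snd (EqClosure.return uv) }
      ; complete = weaken ∘ cpl }
    ... | no a≁b = record
      { count = k
      ; class = merge a≁b ∘ cl
      ; surjective = λ x → let (i , p) = merge-surj a≁b x ; (u , q) = surj i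
                           in u , trans (cong (merge a≁b) q) p
      ; sound = fold (merge a≁b ∘ cl) λ
          { (here refl) → merge-eq a≁b
          ; (there uv)  → cong (merge a≁b) (snd (EqClosure.return uv)) }
      ; complete = λ eq → case merge-kernel a≁b eq of λ
          { (inj₁ p)              → weaken (cpl p)
          ; (inj₂ (inj₁ (p , q))) → EqClosure.transitive _ (weaken (cpl p))
              (fwd (here refl) ◅ weaken (cpl (sym q)))
          ; (inj₂ (inj₂ (p , q))) → EqClosure.transitive _ (weaken (cpl p))
              (bwd (here refl) ◅ weaken (cpl (sym q))) } }

components : (es : List (Fin n × Fin n)) → Components es
components []       = record
  { count = _ ; class = id ; surjective = λ i → i , refl
  ; sound = fold id (λ ()) ; complete = λ { refl → ε } }
components (e ∷ es) = addEdge e (components es)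

select : Vec A k → Subset k → List A
select []       []          = []
select (x ∷ xs) (true  ∷ s) = x ∷ select xs s
select (x ∷ xs) (false ∷ s) = select xs s

rank : Graph n k → Subset k → ℕ
rank {n} G S = n ∸ Components.count (components (select G S))

relabel : (Fin n → Fin N) → Graph n k → Graph N k
relabel f = Vec.map (map f f)

delete : Graph n (suc k) → Fin (suc k) → Graph n k
delete = removeAt

-- The vertices of G/e are the connected components of the spanning subgraph
-- with the single edge e, so for a loop e contraction agrees with deletion.
module _ (G : Graph n (suc k)) (e : Fin (suc k)) where
  private module C = Components (components (lookup G e ∷ []))

  contract : Graph C.count k
  contract = relabel C.class (removeAt G e)

------------------------------------------------------------------------
-- The Negami polynomial

open module ℤ-Polynomials = Polynomials ℤₚ.+-*-commutativeRing public

-- The three variables are t, x, y in this order.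
X Y : Poly (Vec ℕ 3)
X = monomial (0 ∷ 1 ∷ 0 ∷ [])
Y = monomial (0 ∷ 0 ∷ 1 ∷ [])

-- The recursion is run on the first edge; `negami-deletion-contraction` shows
-- that it then holds for every edge.
negami : Graph n k → Poly (Vec ℕ 3)
negami {n} {zero}  G = monomial (n ∷ 0 ∷ 0 ∷ [])
negami {n} {suc k} G = X * negami (contract G zero) + Y * negami (delete G zero)

private
  relabel-∘ : ∀ {n N M k} (f : Fin N → Fin M) (g : Fin n → Fin N) (G : Graph n k) →
              relabel f (relabel g G) ≡ relabel (f ∘ g) G
  relabel-∘ f g G = sym (Vecₚ.map-∘ _ _ G)

  -- Two surjections with the same kernel give isomorphic relabelled graphs.
  negami-kernel : ∀ {N n n′ k} (G : Graph N k) (q : Fin N → Fin n) (q′ : Fin N → Fin n′) →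
    (∀ i → ∃ λ u → q u ≡ i) → (∀ i → ∃ λ u → q′ u ≡ i) →
    (∀ {u v} → q u ≡ q v → q′ u ≡ q′ v) → (∀ {u v} → q′ u ≡ q′ v → q u ≡ q v) →
    negami (relabel q G) ≡ negami (relabel q′ G)
  negami-kernel [] q q′ sq sq′ to from =
    cong (λ n → monomial (n ∷ 0 ∷ 0 ∷ [])) (ℕₚ.≤-antisym (bound sq from) (bound sq′ to))
    where
    bound : ∀ {N n n′} {q : Fin N → Fin n} {q′ : Fin N → Fin n′}
            (s : ∀ i → ∃ λ u → q u ≡ i) → (∀ {u v} → q′ u ≡ q′ v → q u ≡ q v) → n ≤ n′
    bound {q′ = q′} s from = injective⇒≤ {f = q′ ∘ proj₁ ∘ s} λ {i} {j} eq →
      trans (sym (proj₂ (s i))) (trans (from eq) (proj₂ (s j)))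
  negami-kernel ((a , b) ∷ G) q q′ sq sq′ to from = cong₂ (λ p p′ → X * p + Y * p′)
    (begin
      negami (relabel C.class (relabel q G))    ≡⟨ cong negami (relabel-∘ C.class q G) ⟩
      negami (relabel (C.class ∘ q) G)          ≡⟨ negami-kernel G _ _ (surj sq C) (surj sq′ C′)
                                                     (transfer q q′ sq to) (transfer q′ q sq′ from) ⟩
      negami (relabel (C′.class ∘ q′) G)        ≡⟨ cong negami (relabel-∘ C′.class q′ G) ⟨
      negami (relabel C′.class (relabel q′ G))  ∎)
    (negami-kernel G q q′ sq sq′ to from)
    where
    open ≡-Reasoning
    C = components ((q a , q b) ∷ [])
    C′ = components ((q′ a , q′ b) ∷ [])
    module C = Components C
    module C′ = Components C′

    surj : ∀ {N n} {q : Fin N → Fin n} {es} → (∀ i → ∃ λ u → q u ≡ i) → (D : Components es) →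
           ∀ i → ∃ λ u → Components.class D (q u) ≡ i
    surj s D i = let (j , p) = Components.surjective D i ; (u , p′) = s j
                 in u , trans (cong (Components.class D) p′) p

    transfer : ∀ {n n′} (q : Fin _ → Fin n) (q′ : Fin _ → Fin n′) → (∀ i → ∃ λ u → q u ≡ i) →
      (∀ {u v} → q u ≡ q v → q′ u ≡ q′ v) → ∀ {u v} →
      let class  = Components.class (components ((q a , q b) ∷ []))
          class′ = Components.class (components ((q′ a , q′ b) ∷ [])) in
      class (q u) ≡ class (q v) → class′ (q′ u) ≡ class′ (q′ v)
    transfer q q′ s to {u} {v} eq = trans (sym (g∘q u)) (trans (g-eq eq) (g∘q v))
      where
      D = components ((q a , q b) ∷ [])
      D′ = components ((q′ a , q′ b) ∷ [])
      g = λ i → Components.class D′ (q′ (proj₁ (s i)))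
      g∘q : ∀ u → g (q u) ≡ Components.class D′ (q′ u)
      g∘q u = cong (Components.class D′) (to (proj₂ (s (q u))))
      g-eq : ∀ {i j} → Components.class D i ≡ Components.class D j → g i ≡ g j
      g-eq p = fold g (λ { (here refl) → trans (g∘q a) (trans
        (Components.sound D′ (EqClosure.return (here refl))) (sym (g∘q b))) })
        (Components.complete D p)

  -- Contracting e then f, or f then e.
  negami-commute : ∀ (e f : Fin n × Fin n) (G : Graph n k) →
    let c  = Components.class (components (e ∷ []))
        d  = Components.class (components (f ∷ []))
        c′ = Components.class (components (map d d e ∷ []))
        d′ = Components.class (components (map c c f ∷ []))
    in negami (relabel d′ (relabel c G)) ≡ negami (relabel c′ (relabel d G))
  negami-commute {n} (a , b) (c , d) G = begin
    negami (relabel Efirst.D′.class (relabel Efirst.C.class G))  ≡⟨ cong negami (relabel-∘ Efirst.D′.class Efirst.C.class G) ⟩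
    negami (relabel (Efirst.D′.class ∘ Efirst.C.class) G)        ≡⟨ negami-kernel G _ _
                                                       (surj (a , b) (c , d)) (surj (c , d) (a , b))
                                                       (transfer (a , b) (c , d)) (transfer (c , d) (a , b)) ⟩
    negami (relabel (Ffirst.D′.class ∘ Ffirst.C.class) G)        ≡⟨ cong negami (relabel-∘ Ffirst.D′.class Ffirst.C.class G) ⟨
    negami (relabel Ffirst.D′.class (relabel Ffirst.C.class G))  ∎
    where
    open ≡-Reasoning
    module One (e f : Fin n × Fin n) where
      C = components (e ∷ [])
      module C = Components C
      D′ = components (map C.class C.class f ∷ [])
      module D′ = Components D′
      both : Fin n → Fin D′.count
      both = D′.class ∘ C.class
    module Efirst = One (a , b) (c , d)
    module Ffirst = One (c , d) (a , b)

    surj : ∀ e f i → ∃ λ u → One.both e f u ≡ i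
    surj e f i = let (j , p) = P.D′.surjective i ; (u , q) = P.C.surjective j
                 in u , trans (cong P.D′.class q) p
      where module P = One e f

    transfer : ∀ e f {u v} → One.both e f u ≡ One.both e f v → One.both f e u ≡ One.both f e v
    transfer e f {u} {v} eq = trans (sym (g∘class u)) (trans
      (fold g (λ { (here refl) → trans (g∘class _) (trans h-f (sym (g∘class _))) }) (P.D′.complete eq))
      (g∘class v))
      where
      module P = One e f
      module Q = One f e
      h-e : Q.both (proj₁ e) ≡ Q.both (proj₂ e)
      h-e = Q.D′.sound (EqClosure.return (here refl))
      h-f : Q.both (proj₁ f) ≡ Q.both (proj₂ f)
      h-f = cong Q.D′.class (Q.C.sound (EqClosure.return (here refl)))
      g : Fin P.C.count → Fin Q.D′.count
      g i = Q.both (proj₁ (P.C.surjective i))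
      g∘class : ∀ u → g (P.C.class u) ≡ Q.both u
      g∘class u = fold Q.both (λ { (here refl) → h-e })
        (P.C.complete (proj₂ (P.C.surjective (P.C.class u))))

  removeAt-map : ∀ {A B : Set} {k} (f : A → B) (xs : Vec A (suc k)) i →
                 removeAt (Vec.map f xs) i ≡ Vec.map f (removeAt xs i)
  removeAt-map f (x ∷ xs)         zero    = refl
  removeAt-map f (x ∷ xs@(_ ∷ _)) (suc i) = cong (f x ∷_) (removeAt-map f xs i)

  XY-comm : ∀ p → X * (Y * p) ≡ Y * (X * p)
  XY-comm p = begin
    X * (Y * p)                               ≡⟨ Listₚ.++-identityʳ _ ⟩
    List.map _ (List.map _ p ++ [])           ≡⟨ cong (List.map _) (Listₚ.++-identityʳ _) ⟩
    List.map _ (List.map _ p)                 ≡⟨ Listₚ.map-∘ p ⟨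
    List.map _ p                              ≡⟨ Listₚ.map-cong (λ { (c , _ ∷ _ ∷ _ ∷ []) → refl }) p ⟩
    List.map _ p                              ≡⟨ Listₚ.map-∘ p ⟩
    List.map _ (List.map _ p)                 ≡⟨ cong (List.map _) (Listₚ.++-identityʳ _) ⟨
    List.map _ (List.map _ p ++ [])           ≡⟨ Listₚ.++-identityʳ _ ⟨
    Y * (X * p)                               ∎
    where open ≡-Reasoning

  monomial-distrib : ∀ d (p q : Poly (Vec ℕ 3)) →
    monomial d * (p + q) ≡ monomial d * p + monomial d * q
  monomial-distrib d p q = begin
    List.map _ (p ++ q) ++ []                   ≡⟨ Listₚ.++-identityʳ _ ⟩
    List.map _ (p ++ q)                         ≡⟨ Listₚ.map-++ _ p q ⟩
    List.map _ p ++ List.map _ q                ≡⟨ cong₂ _++_ (sym (Listₚ.++-identityʳ (List.map _ p)))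
                                                              (sym (Listₚ.++-identityʳ (List.map _ q))) ⟩
    monomial d * p + monomial d * q             ∎
    where open ≡-Reasoning

  monomial-↭ : ∀ d {p q : Poly (Vec ℕ 3)} → p ↭ q → monomial d * p ↭ monomial d * q
  monomial-↭ d p↭q = Permₚ.++⁺ʳ [] (Permₚ.map⁺ _ p↭q)

  negami-↭ : ∀ (G : Graph n (suc k)) e →
    negami G ↭ X * negami (contract G e) + Y * negami (delete G e)
  negami-↭ G zero = ↭-refl
  negami-↭ {n} (a ∷ G@(_ ∷ _)) (suc i) = begin
    X * negami (relabel C.class G) + Y * negami G
      ↭⟨ Permₚ.++⁺ (monomial-↭ _ (negami-↭ (relabel C.class G) i)) (monomial-↭ _ (negami-↭ G i)) ⟩
    X * (X * negami (contract (relabel C.class G) i) + Y * negami (delete (relabel C.class G) i))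
      + Y * (X * p₁₀ + Y * p₀₀)
      ≡⟨ cong₂ (λ p q → X * (X * p + Y * q) + Y * (X * p₁₀ + Y * p₀₀)) eq₁₁
           (cong negami (removeAt-map _ G i)) ⟩
    X * (X * p₁₁ + Y * p₀₁) + Y * (X * p₁₀ + Y * p₀₀)
      ≡⟨ cong₂ _+_ (monomial-distrib _ (X * p₁₁) _) (monomial-distrib _ (X * p₁₀) _) ⟩
    (X * (X * p₁₁) + X * (Y * p₀₁)) + (Y * (X * p₁₀) + Y * (Y * p₀₀))
      ≡⟨ cong₂ (λ p q → (X * (X * p₁₁) + p) + (q + Y * (Y * p₀₀))) (XY-comm p₀₁) (sym (XY-comm p₁₀)) ⟩
    (X * (X * p₁₁) + Y * (X * p₀₁)) + (X * (Y * p₁₀) + Y * (Y * p₀₀))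
      ↭⟨ exchange (X * (X * p₁₁)) (Y * (X * p₀₁)) (X * (Y * p₁₀)) (Y * (Y * p₀₀)) ⟩
    (X * (X * p₁₁) + X * (Y * p₁₀)) + (Y * (X * p₀₁) + Y * (Y * p₀₀))
      ≡⟨ cong₂ _+_ (monomial-distrib _ (X * p₁₁) _) (monomial-distrib _ (X * p₀₁) _) ⟨
    X * (X * p₁₁ + Y * p₁₀) + Y * (X * p₀₁ + Y * p₀₀) ∎
    where
    open Perm.PermutationReasoning
    module C = Components (components (a ∷ []))
    module D = Components (components (lookup G i ∷ []))
    p₁₁ = negami (contract (relabel D.class (a ∷ removeAt G i)) zero)
    p₁₀ = negami (relabel D.class (removeAt G i))
    p₀₁ = negami (relabel C.class (removeAt G i))
    p₀₀ = negami (removeAt G i)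

    eq₁₁ : negami (contract (relabel C.class G) i) ≡ p₁₁
    eq₁₁ = trans
      (cong₂ (λ (f : Fin C.count × Fin C.count) H →
                negami (relabel (Components.class (components (f ∷ []))) H))
             (Vecₚ.lookup-map i _ G) (removeAt-map _ G i))
      (negami-commute a (lookup G i) (removeAt G i))

    exchange : ∀ (p q s t : Poly (Vec ℕ 3)) → (p + q) + (s + t) ↭ (p + s) + (q + t)
    exchange p q s t = begin
      (p ++ q) ++ (s ++ t)  ≡⟨ Listₚ.++-assoc p q (s ++ t) ⟩
      p ++ q ++ s ++ t      ↭⟨ Permₚ.++⁺ˡ p (Permₚ.shifts q s) ⟩
      p ++ s ++ q ++ t      ≡⟨ Listₚ.++-assoc p s (q ++ t) ⟨
      (p ++ s) ++ (q ++ t)  ∎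

negami-deletion-contraction : ∀ (G : Graph n (suc k)) e →
  negami G ≈ X * negami (contract G e) + Y * negami (delete G e)
negami-deletion-contraction G e = ↭⇒≈ (negami-↭ G e)

------------------------------------------------------------------------
-- The squarefree edge algebra and its rank filtration

module EdgeAlgebra {c ℓ₁ ℓ₂} (𝕜 : HeytingField c ℓ₁ ℓ₂) {n k} (G : Graph n k) where

  private
    K : CommutativeRing c ℓ₁
    K = HeytingCommutativeRing.commutativeRing (HeytingField.heytingCommutativeRing 𝕜)

    module 𝕜[z] = Polynomials K

  open Modules (CommutativeRing.ring K)

  𝕜[z]-module : LeftModule (CommutativeRing.ring K) c ℓ₁
  𝕜[z]-module = 𝕜[z].polyModule {Vec ℕ k}

  zᵢ : Fin k → 𝕜[z].Poly (Vec ℕ k)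
  zᵢ i = 𝕜[z].monomial (replicate k 0 Vec.[ i ]≔ 1)

  z : Subset k → 𝕜[z].Poly (Vec ℕ k)
  z S = 𝕜[z].monomial (Vec.map (if_then 1 else 0) S)

  -- The ideal (zᵢ²) is the 𝕜-span of all multiples of the zᵢ².
  squares : Submodule 𝕜[z]-module _
  squares = span 𝕜[z]-module λ p → ∃ λ q → ∃ λ i → p ≡ q 𝕜[z].* (zᵢ i 𝕜[z].^ 2)

  -- Only the vector-space structure of the quotient algebra is needed below.
  B : LeftModule (CommutativeRing.ring K) _ _
  B = 𝕜[z]-module / squares

  filtration : ℕ → Submodule B _
  filtration p = span B λ v → ∃ λ S → rank G S ≤ p × v ≡ z S

  -- F₍ₚ₋₁₎, with F₋₁ = 0.
  filtrationBelow : ℕ → Submodule B _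
  filtrationBelow zero    = zeroSubmodule B
  filtrationBelow (suc p) = filtration p

  homogeneous : ℕ → Submodule B _
  homogeneous d = span B λ v → ∃ λ S → ∣ S ∣ ≡ d × v ≡ z S

  -- The degree-d part of Fₚ / Fₚ₋₁, that is, the image of Fₚ ∩ B_d in Fₚ / Fₚ₋₁.
  gr : ℕ → ℕ → LeftModule (CommutativeRing.ring K) _ _
  gr p d = asModule B U / restrict B U (filtrationBelow p)
    where U = _∩_ B (filtration p) (homogeneous d)

  -- H(u,s) = Σ dim(gr p d) uᵖ sᵈ.
  IsHilbertPolynomial : Poly (Vec ℕ 2) → Set _
  IsHilbertPolynomial H = ∀ p d → ∃ λ n → HasDimension (gr p d) n × coeff H (p ∷ d ∷ []) ≡ + n

C₃ : Graph 3 3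
C₃ = (0F , 1F) ∷ (1F , 2F) ∷ (2F , 0F) ∷ []

u s : Poly (Vec ℕ 2)
u = monomial (1 ∷ 0 ∷ [])
s = monomial (0 ∷ 1 ∷ [])

t t⁻¹ x y y⁻¹ : Poly (Vec ℤ 3)
t   = monomial (+ 1 ∷ + 0 ∷ + 0 ∷ [])
t⁻¹ = monomial (-[1+ 0 ] ∷ + 0 ∷ + 0 ∷ [])
x   = monomial (+ 0 ∷ + 1 ∷ + 0 ∷ [])
y   = monomial (+ 0 ∷ + 0 ∷ + 1 ∷ [])
y⁻¹ = monomial (+ 0 ∷ + 0 ∷ -[1+ 0 ] ∷ [])

module Submission where

-- Taking the coefficient of z_S is well defined on B_G, since no multiple of a
-- zᵢ² contains a squarefree monomial; and the span of any set of z_S consists of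
-- the elements whose other squarefree coefficients vanish.  Hence the z_S with
-- ρ(S) = p and |S| = d form a basis of the (p , d) part of gr B_G, for every graph
-- G, and H_G(u,s) = Σ_S u^ρ(S) s^|S|.  For G = C₃ both identities are then finite
-- computations: polynomials are equal as soon as their coefficients agree on the
-- exponents that occur in them.

open import Level using (Level)
open import Algebra.Apartness using (HeytingField; module HeytingField; module HeytingCommutativeRing)
open import Algebra.Bundles using (CommutativeRing)
open import Algebra.Module.Bundles using (LeftModule)
import Algebra.Definitions.RawMonoid as RawMonoid
import Algebra.Properties.CommutativeMonoid.Sum as Summation
import Algebra.Properties.Ring as RingProperties
open import Data.Bool using (true; false; if_then_else_)
open import Data.Fin using (Fin; zero; suc; punchIn)
import Data.Fin.Properties as Finₚ
open import Data.Fin.Subset using (Subset; ∣_∣)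
open import Data.Fin.Subset.Properties using (anySubset?)
open import Data.Integer as ℤ using (+_)
import Data.Integer.Properties as ℤₚ
open import Data.List as List using (List; []; _∷_; filter; length)
open import Data.List.Membership.Propositional using (_∈_; _∉_)
open import Data.List.Membership.Propositional.Properties
  using (∈-cartesianProductWith⁺; ∈-filter⁺; ∈-filter⁻; ∈-lookup; ∈-++⁺ˡ; ∈-++⁺ʳ)
open import Data.List.Relation.Unary.All as All using (All; []; _∷_; all?)
import Data.List.Relation.Unary.All.Properties as Allₚ
open import Data.List.Relation.Unary.AllPairs using ([]; _∷_)
open import Data.List.Relation.Unary.Any as Any using (here; there; index)
open import Data.List.Relation.Unary.Any.Properties using (lookup-index)
open import Data.List.Relation.Unary.Unique.Propositional using (Unique)
import Data.List.Relation.Unary.Unique.Propositional.Properties as Uniqueₚ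
open import Data.Nat using (ℕ; zero; suc; _≤_; _<_; _≤?_; s≤s)
import Data.Nat.Properties as ℕₚ
open import Data.Product using (∃; ∃₂; _×_; _,_; proj₁; proj₂)
open import Data.Sum using (_⊎_; inj₁; inj₂)
open import Data.Vec using (Vec; []; _∷_)
import Data.Vec as Vec
import Data.Vec.Properties as Vecₚ
open import Function using (_∘_)
open import Relation.Binary.PropositionalEquality as ≡ using (_≡_; _≢_; refl; cong; cong₂)
open import Relation.Nullary using (¬_; Dec; does; yes; no; contradiction)
open import Relation.Nullary.Decidable using (True; toWitness; ¬?; _×-dec_; decidable-stable)
open import Relation.Unary using (Decidable)
open import Defs

private variable
  E : Set
  k n : ℕ

-- Enumeration of the subsets of the edge set without repetition.

subsets : ∀ k → List (Subset k)
subsets zero    = [] ∷ []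
subsets (suc k) = List.cartesianProductWith _∷_ (true ∷ false ∷ []) (subsets k)

∈-subsets : (S : Subset k) → S ∈ subsets k
∈-subsets []          = here refl
∈-subsets (true  ∷ S) = ∈-cartesianProductWith⁺ _∷_ {xs = true ∷ false ∷ []} (here refl) (∈-subsets S)
∈-subsets (false ∷ S) = ∈-cartesianProductWith⁺ _∷_ {xs = true ∷ false ∷ []} (there (here refl)) (∈-subsets S)

subsets-unique : ∀ k → Unique (subsets k)
subsets-unique zero    = [] ∷ []
subsets-unique (suc k) = Uniqueₚ.cartesianProductWith⁺ _∷_ Vecₚ.∷-injective
  (((λ ()) ∷ []) ∷ [] ∷ []) (subsets-unique k)

lookup-injective : {xs : List E} → Unique xs → ∀ i j → List.lookup xs i ≡ List.lookup xs j → i ≡ j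
lookup-injective (_  ∷ _)  zero    zero    _  = refl
lookup-injective (x≢ ∷ _)  zero    (suc j) eq = contradiction eq (All.lookup x≢ (∈-lookup j))
lookup-injective (x≢ ∷ _)  (suc i) zero    eq = contradiction (≡.sym eq) (All.lookup x≢ (∈-lookup i))
lookup-injective (_  ∷ xs) (suc i) (suc j) eq = cong suc (lookup-injective xs i j eq)

-- Squarefree exponents and exponents divisible by a square.

indicator : Subset k → Vec ℕ k
indicator = Vec.map (if_then 1 else 0)

indicator-injective : {S T : Subset k} → indicator S ≡ indicator T → S ≡ T
indicator-injective {S = []}        {[]}        _  = refl
indicator-injective {S = true ∷ _}  {true ∷ _}  eq = cong (true ∷_) (indicator-injective (Vecₚ.∷-injectiveʳ eq))
indicator-injective {S = false ∷ _} {false ∷ _} eq = cong (false ∷_) (indicator-injective (Vecₚ.∷-injectiveʳ eq))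

open Exponents ⦃ ... ⦄

-- Written as δ ⊕ (δ ⊕ unit) because that is the exponent to which zᵢ i ^ 2 reduces.
2δ : Fin k → Vec ℕ k
2δ {k} i = δ ⊕ (δ ⊕ unit)
  where δ = Vec.replicate k 0 Vec.[ i ]≔ 1

-- Either every entry is at most 1, or the first entry that is at least 2 can be lowered by 2. So
-- each monomial is some `z S` or lies in the ideal of squares.
squarefree⊎square : (e : Vec ℕ k) → (∃ λ S → e ≡ indicator S) ⊎ (∃₂ λ d i → e ≡ d ⊕ 2δ i)
squarefree⊎square []                = inj₁ ([] , refl)
squarefree⊎square (suc (suc n) ∷ e) = inj₂ (n ∷ e , zero , cong₂ _∷_ (ℕₚ.+-comm 2 n) (begin
  e                           ≡⟨ identityʳ e ⟨
  e ⊕ unit                    ≡⟨ cong (e ⊕_) (identityʳ unit) ⟨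
  e ⊕ (unit ⊕ unit)           ≡⟨ cong (λ f → e ⊕ (unit ⊕ f)) (identityʳ unit) ⟨
  e ⊕ (unit ⊕ (unit ⊕ unit))  ∎))
  where
  open ≡.≡-Reasoning
  identityʳ = Vecₚ.zipWith-identityʳ ℕₚ.+-identityʳ
squarefree⊎square (0 ∷ e) with squarefree⊎square e
... | inj₁ (S , eq)     = inj₁ (false ∷ S , cong (0 ∷_) eq)
... | inj₂ (d , i , eq) = inj₂ (0 ∷ d , suc i , cong (0 ∷_) eq)
squarefree⊎square (1 ∷ e) with squarefree⊎square e
... | inj₁ (S , eq)     = inj₁ (true ∷ S , cong (1 ∷_) eq)
... | inj₂ (d , i , eq) = inj₂ (1 ∷ d , suc i , cong (1 ∷_) eq)

-- The entry at `i` is at least 2 on the left and at most 1 on the right.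
square≢indicator : ∀ (d : Vec ℕ k) i S → d ⊕ 2δ i ≢ indicator S
square≢indicator (zero  ∷ d) zero    (true ∷ S) ()
square≢indicator (suc m ∷ d) zero    (true ∷ S) eq
  -- The heads give `m + 2 ≡ 0`, which is visibly absurd only after a successor is moved to the
  -- front.
  with () ← ≡.trans (≡.sym (ℕₚ.+-suc m 1)) (ℕₚ.suc-injective (Vecₚ.∷-injectiveˡ eq))
square≢indicator (zero  ∷ d) zero    (false ∷ S) ()
square≢indicator (suc m ∷ d) zero    (false ∷ S) ()
square≢indicator (_     ∷ d) (suc i) (_ ∷ S) eq = square≢indicator d i S (Vecₚ.∷-injectiveʳ eq)

-- Coefficients of polynomials over a commutative ring.

module Coefficients {r ℓ} (R : CommutativeRing r ℓ) {E : Set} ⦃ exponents : Exponents E ⦄ where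
  private
    module R = CommutativeRing R
    module P = Polynomials R
    open import Relation.Binary.Reasoning.Setoid R.setoid
    open RingProperties R.ring using (-1*x≈-x)

  coeff-+ : ∀ (p q : P.Poly E) e → P.coeff (p P.+ q) e R.≈ P.coeff p e R.+ P.coeff q e
  coeff-+ []      q e = R.sym (R.+-identityˡ _)
  coeff-+ (_ ∷ p) q e = R.trans (R.+-congˡ (coeff-+ p q e)) (R.sym (R.+-assoc _ _ _))

  coeff-· : ∀ c (p : P.Poly E) e → P.coeff (c P.· p) e R.≈ c R.* P.coeff p e
  coeff-· c []            e = R.sym (R.zeroʳ c)
  coeff-· c ((a , d) ∷ p) e with does (d ≟ᴱ e)
  ... | true  = R.trans (R.+-congˡ (coeff-· c p e)) (R.sym (R.distribˡ c _ _))
  ... | false = R.trans (R.+-cong (R.sym (R.zeroʳ c)) (coeff-· c p e)) (R.sym (R.distribˡ c _ _))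

  coeff-minus : ∀ (p q : P.Poly E) e → P.coeff (p P.+ (R.- R.1#) P.· q) e R.≈ P.coeff p e R.- P.coeff q e
  coeff-minus p q e = begin
    P.coeff (p P.+ (R.- R.1#) P.· q) e             ≈⟨ coeff-+ p _ e ⟩
    P.coeff p e R.+ P.coeff ((R.- R.1#) P.· q) e   ≈⟨ R.+-congˡ (coeff-· _ q e) ⟩
    P.coeff p e R.+ (R.- R.1#) R.* P.coeff q e     ≈⟨ R.+-congˡ (-1*x≈-x _) ⟩
    P.coeff p e R.- P.coeff q e                    ∎

  coeff-∉ : ∀ (p : P.Poly E) {e} → e ∉ List.map proj₂ p → P.coeff p e R.≈ R.0#
  coeff-∉ []            e∉ = R.refl
  coeff-∉ ((a , d) ∷ p) {e} e∉ with d ≟ᴱ e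
  ... | yes refl = contradiction (here refl) e∉
  ... | no _     = R.trans (R.+-identityˡ _) (coeff-∉ p (e∉ ∘ there))

  coeff-monomial : ∀ (d : E) → P.coeff (P.monomial d) d R.≈ R.1#
  coeff-monomial d with d ≟ᴱ d
  ... | yes _  = R.+-identityʳ _
  ... | no d≢d = contradiction refl d≢d

  coeff-monomial-≢ : ∀ {d e : E} → d ≢ e → P.coeff (P.monomial d) e R.≈ R.0#
  coeff-monomial-≢ d≢e = coeff-∉ (P.monomial _) λ { (here refl) → d≢e refl }

  term-cong : ∀ {a b} → a R.≈ b → ∀ (d : E) → ((a , d) ∷ []) P.≈ ((b , d) ∷ [])
  term-cong a≈b d e with does (d ≟ᴱ e)
  ... | true  = R.+-congʳ a≈b
  ... | false = R.refl

  -- Terms may repeat an exponent and cancel, so the discarded terms need not be zero one by one;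
  -- only their total at each exponent vanishes. At an exponent in `Q` no term is discarded.
  filter-≈ : ∀ {q} {Q : E → Set q} (Q? : Decidable Q) (p : P.Poly E) →
             (∀ e → ¬ Q e → P.coeff p e R.≈ R.0#) → filter (Q? ∘ proj₂) p P.≈ p
  filter-≈ {Q = Q} Q? p vanish e with Q? e
  ... | yes qe = keep p
    where
    keep : ∀ p → P.coeff (filter (Q? ∘ proj₂) p) e R.≈ P.coeff p e
    keep []            = R.refl
    keep ((a , d) ∷ p) with Q? d
    ... | yes _ = R.+-congˡ (keep p)
    ... | no ¬q with d ≟ᴱ e
    ...   | yes refl = contradiction qe ¬q
    ...   | no _     = R.trans (keep p) (R.sym (R.+-identityˡ _))
  ... | no ¬qe = R.trans
    (coeff-∉ (filter (Q? ∘ proj₂) p) λ e∈ →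
      ¬qe (All.lookup (Allₚ.map⁺ (Allₚ.all-filter (Q? ∘ proj₂) p)) e∈))
    (R.sym (vanish e ¬qe))

-- Integer polynomials: equality by evaluation, and the two identities for the triangle.

open Coefficients ℤₚ.+-*-commutativeRing using (coeff-∉)

agree? : ⦃ _ : Exponents E ⦄ (p q : Poly E) →
         Dec (All (λ e → coeff p e ≡ coeff q e) (List.map proj₂ p List.++ List.map proj₂ q))
agree? p q = all? (λ e → coeff p e ℤₚ.≟ coeff q e) _

-- An exponent that occurs in neither list has coefficient zero on both sides. For closed
-- polynomials the implicit argument evaluates to the unit type and is filled in automatically.
agree⇒≈ : ⦃ _ : Exponents E ⦄ (p q : Poly E) {_ : True (agree? p q)} → p ≈ q
agree⇒≈ p q {agree} e
  with Any.any? (e ≟ᴱ_) (List.map proj₂ p List.++ List.map proj₂ q)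
... | yes e∈ = All.lookup (toWitness agree) e∈
... | no e∉  = ≡.trans (coeff-∉ p (e∉ ∘ ∈-++⁺ˡ)) (≡.sym (coeff-∉ q (e∉ ∘ ∈-++⁺ʳ _)))

bidegree : Graph n k → Subset k → Vec ℕ 2
bidegree G S = rank G S ∷ ∣ S ∣ ∷ []

-- A form of the Whitney rank generating polynomial, graded by size instead of nullity. Equal
-- bidegrees stay as separate terms, so a coefficient is a count of subsets.
hilbert : Graph n k → Poly (Vec ℕ 2)
hilbert {k = k} G = List.map (λ S → + 1 , bidegree G S) (subsets k)

coeff-hilbert : ∀ (G : Graph n k) e →
  coeff (hilbert G) e ≡ + length (filter (λ S → bidegree G S ≟ᴱ e) (subsets k))
coeff-hilbert {k = k} G e = count (subsets k)
  where
  count : ∀ Ss → coeff (List.map (λ S → + 1 , bidegree G S) Ss) e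
                 ≡ + length (filter (λ S → bidegree G S ≟ᴱ e) Ss)
  count []       = refl
  count (S ∷ Ss) with does (bidegree G S ≟ᴱ e)
  ... | true  = cong (ℤ._+_ (+ 1)) (count Ss)
  ... | false = ≡.trans (ℤₚ.+-identityˡ _) (count Ss)

hilbert-C₃ : hilbert C₃ ≈ const (+ 1) + const (+ 3) * u * s + const (+ 3) * u ^ 2 * s ^ 2 + u ^ 2 * s ^ 3
hilbert-C₃ = agree⇒≈ (hilbert C₃) (const (+ 1) + const (+ 3) * u * s + const (+ 3) * u ^ 2 * s ^ 2 + u ^ 2 * s ^ 3)

-- Unfolding deletion and contraction yields the sum over edge sets `A` of t^k(A) x^|A| y^(3-|A|),
-- and k(A) = 3 - ρ(A) turns this into the right-hand side. For this closed graph the comparison is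
-- done by evaluation.
negami-C₃ : negami C₃ ⟦ t ∷ x ∷ y ∷ [] ⟧ ≈ t ^ 3 * y ^ 3 * hilbert C₃ ⟦ t⁻¹ ∷ x * y⁻¹ ∷ [] ⟧
negami-C₃ = agree⇒≈ (negami C₃ ⟦ t ∷ x ∷ y ∷ [] ⟧) (t ^ 3 * y ^ 3 * hilbert C₃ ⟦ t⁻¹ ∷ x * y⁻¹ ∷ [] ⟧)

-- Squarefree coordinates on the edge algebra and membership in spans of monomials.

module EdgeAlgebraBasis {c ℓ₁ ℓ₂} (𝕜 : HeytingField c ℓ₁ ℓ₂) {n k} (G : Graph n k) where
  private
    K : CommutativeRing c ℓ₁
    K = HeytingCommutativeRing.commutativeRing (HeytingField.heytingCommutativeRing 𝕜)
    module K = CommutativeRing K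
    module P = Polynomials K

  open EdgeAlgebra 𝕜 G
  open Modules K.ring
  open Coefficients K {E = Vec ℕ k}
    using (coeff-+; coeff-·; coeff-minus; coeff-monomial; coeff-monomial-≢; term-cong; filter-≈)
  open RingProperties K.ring using (x∙y⁻¹≈ε⇒x≈y; x≈y⇒x∙y⁻¹≈ε)
  open Summation K.+-commutativeMonoid using (sum; sum-cong-≋; sum-remove; sum-replicate-zero)
  open import Relation.Binary.Reasoning.Setoid K.setoid

  private module B = LeftModule B

  -- Defined on representatives; `coordinate-cong` makes it a function on `B`.
  coordinate : P.Poly (Vec ℕ k) → Subset k → K.Carrier
  coordinate v S = P.coeff v (indicator S)

  squares⇒0 : ∀ {v} → Member squares v → ∀ S → coordinate v S K.≈ K.0#
  squares⇒0 (gen (q , i , refl)) S = multiple q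
    where
    multiple : ∀ q → coordinate (q P.* (zᵢ i P.^ 2)) S K.≈ K.0#
    multiple []            = K.refl
    multiple ((a , d) ∷ q) with (d ⊕ 2δ i) ≟ᴱ indicator S
    ... | yes eq = contradiction eq (square≢indicator d i S)
    ... | no _   = K.trans (K.+-identityˡ _) (multiple q)
  squares⇒0 (resp v≈w p)         S = K.trans (K.sym (v≈w (indicator S))) (squares⇒0 p S)
  squares⇒0 zero∈                S = K.refl
  squares⇒0 (add∈ {v} {w} p q)   S = begin
    coordinate (v P.+ w) S             ≈⟨ coeff-+ v w _ ⟩
    coordinate v S K.+ coordinate w S  ≈⟨ K.+-cong (squares⇒0 p S) (squares⇒0 q S) ⟩
    K.0# K.+ K.0#                      ≈⟨ K.+-identityˡ _ ⟩
    K.0#                               ∎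
  squares⇒0 (scale a {v} p)      S = begin
    coordinate (a P.· v) S   ≈⟨ coeff-· a v _ ⟩
    a K.* coordinate v S     ≈⟨ K.*-congˡ (squares⇒0 p S) ⟩
    a K.* K.0#               ≈⟨ K.zeroʳ a ⟩
    K.0#                     ∎

  coordinate-cong : ∀ v w → v B.≈ᴹ w → ∀ S → coordinate v S K.≈ coordinate w S
  coordinate-cong v w v≈w S =
    x∙y⁻¹≈ε⇒x≈y _ _ (K.trans (K.sym (coeff-minus v w _)) (squares⇒0 v≈w S))

  poly≈⇒≈ᴹ : ∀ v w → v P.≈ w → v B.≈ᴹ w
  poly≈⇒≈ᴹ v w v≈w =
    resp (λ e → K.sym (K.trans (coeff-minus v w e) (x≈y⇒x∙y⁻¹≈ε (v≈w e)))) zero∈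

  coordinate-z : ∀ S → coordinate (z S) S K.≈ K.1#
  coordinate-z S = coeff-monomial (indicator S)

  coordinate-z-≢ : ∀ S T → S ≢ T → coordinate (z S) T K.≈ K.0#
  coordinate-z-≢ S T S≢T = coeff-monomial-≢ (S≢T ∘ indicator-injective)

  -- Stated for an arbitrary predicate `Q` so as to serve both the filtration (bounded rank) and the
  -- grading (fixed size).
  span⇒coordinate≈0 : ∀ {q} {Q : Subset k → Set q} {v} →
    Span B (λ w → ∃ λ S → Q S × w ≡ z S) v → ∀ T → ¬ Q T → coordinate v T K.≈ K.0#
  span⇒coordinate≈0 (gen (S , qS , refl)) T ¬qT = coordinate-z-≢ S T λ { refl → ¬qT qS }
  span⇒coordinate≈0 (resp {v} {w} v≈w p) T ¬qT =
    K.trans (K.sym (coordinate-cong v w v≈w T)) (span⇒coordinate≈0 p T ¬qT)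
  span⇒coordinate≈0 zero∈ T ¬qT = K.refl
  span⇒coordinate≈0 (add∈ {v} {w} p q) T ¬qT = begin
    coordinate (v P.+ w) T             ≈⟨ coeff-+ v w _ ⟩
    coordinate v T K.+ coordinate w T  ≈⟨ K.+-cong (span⇒coordinate≈0 p T ¬qT) (span⇒coordinate≈0 q T ¬qT) ⟩
    K.0# K.+ K.0#                      ≈⟨ K.+-identityˡ _ ⟩
    K.0#                               ∎
  span⇒coordinate≈0 (scale a {v} p) T ¬qT = begin
    coordinate (a P.· v) T   ≈⟨ coeff-· a v _ ⟩
    a K.* coordinate v T     ≈⟨ K.*-congˡ (span⇒coordinate≈0 p T ¬qT) ⟩
    a K.* K.0#               ≈⟨ K.zeroʳ a ⟩
    K.0#                     ∎

  -- Such a term is a multiple of the square of a variable, hence zero in `B`, and zero lies in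
  -- every submodule.
  square∈ : ∀ {s} (U : Submodule B s) a d i → Member U ((a , d ⊕ 2δ i) ∷ [])
  square∈ U a d i = U.resp {B.0ᴹ} {term} (B.≈ᴹ-sym {term} {B.0ᴹ} term≈0) U.zero∈
    where
    module U = Submodule U
    term = (a , d ⊕ 2δ i) ∷ []

    term≈0 : term B.≈ᴹ B.0ᴹ
    term≈0 = resp (term-cong (begin
      a K.* (K.1# K.* (K.1# K.* K.1#))  ≈⟨ K.*-congˡ (K.*-identityˡ _) ⟩
      a K.* (K.1# K.* K.1#)             ≈⟨ K.*-congˡ (K.*-identityˡ _) ⟩
      a K.* K.1#                        ≈⟨ K.*-identityʳ a ⟩
      a                                 ∎) (d ⊕ 2δ i))
      (gen (((a , d) ∷ []) , i , refl))

  -- A polynomial whose coordinates off Q vanish equals the sum of its terms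
  -- other than those with exponent `indicator S`, ¬ Q S.
  coordinate≈0⇒∈ : ∀ {s q} (U : Submodule B s) {Q : Subset k → Set q} → Decidable Q →
    (∀ S → Q S → Member U (z S)) →
    ∀ v → (∀ T → ¬ Q T → coordinate v T K.≈ K.0#) → Member U v
  coordinate≈0⇒∈ U {Q} Q? z∈ v vanish =
    U.resp {filter (allowed? ∘ proj₂) v} {v}
      (poly≈⇒≈ᴹ (filter (allowed? ∘ proj₂) v) v (filter-≈ allowed? v vanish′))
      (terms∈ (Allₚ.all-filter (allowed? ∘ proj₂) v))
    where
    module U = Submodule U

    -- The test looks only at exponents, since equality in `𝕜` need not be decidable; a search over
    -- the finitely many subsets decides it.
    excluded? = λ e → anySubset? λ S → ¬? (Q? S) ×-dec (e ≟ᴱ indicator S)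
    allowed? = λ e → ¬? (excluded? e)

    vanish′ : ∀ e → ¬ ¬ (∃ λ S → ¬ Q S × e ≡ indicator S) → P.coeff v e K.≈ K.0#
    vanish′ e ¬allowed with decidable-stable (excluded? e) ¬allowed
    ... | S , ¬qS , refl = vanish S ¬qS

    term∈ : ∀ a e → ¬ (∃ λ S → ¬ Q S × e ≡ indicator S) → Member U ((a , e) ∷ [])
    term∈ a e allowed with squarefree⊎square e
    ... | inj₂ (d , i , refl) = square∈ U a d i
    ... | inj₁ (S , refl)     = U.resp {a P.· z S} {(a , e) ∷ []}
      (poly≈⇒≈ᴹ (a P.· z S) ((a , e) ∷ []) (term-cong (K.*-identityʳ a) e))
      (U.scale∈ a (z∈ S (decidable-stable (Q? S) λ ¬qS → allowed (S , ¬qS , refl))))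

    terms∈ : ∀ {w} → All (λ (a , e) → ¬ (∃ λ S → ¬ Q S × e ≡ indicator S)) w → Member U w
    terms∈ []                           = U.zero∈
    terms∈ {(a , e) ∷ w} (allowed ∷ ok) = U.add∈ {(a , e) ∷ []} {w} (term∈ a e allowed) (terms∈ ok)

  -- Phrasing the condition as rank less than `p` covers F₋₁ = 0 as well: for `p = 0` no subset
  -- qualifies, so all coordinates vanish.
  below⇒coordinate≈0 : ∀ p {v} → Member (filtrationBelow p) v →
    ∀ T → ¬ rank G T < p → coordinate v T K.≈ K.0#
  below⇒coordinate≈0 zero    {v} v≈0 T _    = coordinate-cong v [] v≈0 T
  below⇒coordinate≈0 (suc p)     v∈  T r≮sp = span⇒coordinate≈0 v∈ T (r≮sp ∘ s≤s)

  coordinate≈0⇒below : ∀ p v → (∀ T → ¬ rank G T < p → coordinate v T K.≈ K.0#) →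
    Member (filtrationBelow p) v
  coordinate≈0⇒below p = coordinate≈0⇒∈ (filtrationBelow p) (λ S → rank G S ℕₚ.<? p) (z∈ p)
    where
    z∈ : ∀ p S → rank G S < p → Member (filtrationBelow p) (z S)
    z∈ (suc p) S (s≤s r≤p) = gen (S , r≤p , refl)

  -- A monomial basis of the part of bidegree (`p`, `d`).

  module _ (p d : ℕ) where
    private
      module gr = LeftModule (gr p d)
      open RawMonoid gr.+ᴹ-rawMonoid using () renaming (sum to ∑)

    coordinate-∑ : ∀ {m} (f : Fin m → gr.Carrierᴹ) T →
      coordinate (proj₁ (∑ f)) T K.≈ sum (λ i → coordinate (proj₁ (f i)) T)
    coordinate-∑ {zero}  f T = K.refl
    coordinate-∑ {suc m} f T = K.trans (coeff-+ (proj₁ (f zero)) _ _) (K.+-congˡ (coordinate-∑ (f ∘ suc) T))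

    basisSubsets : List (Subset k)
    basisSubsets = filter (λ S → bidegree G S ≟ᴱ (p ∷ d ∷ [])) (subsets k)

    private
      σ : Fin (length basisSubsets) → Subset k
      σ = List.lookup basisSubsets

      σ-injective : ∀ i j → σ i ≡ σ j → i ≡ j
      σ-injective = lookup-injective (Uniqueₚ.filter⁺ _ (subsets-unique k))

      σ-bidegree : ∀ i → bidegree G (σ i) ≡ p ∷ d ∷ []
      σ-bidegree i = proj₂ (∈-filter⁻ (λ S → bidegree G S ≟ᴱ _) {xs = subsets k} (∈-lookup i))

      σ-rank : ∀ i → rank G (σ i) ≡ p
      σ-rank = Vecₚ.∷-injectiveˡ ∘ σ-bidegree

      σ-size : ∀ i → ∣ σ i ∣ ≡ d
      σ-size = Vecₚ.∷-injectiveˡ ∘ Vecₚ.∷-injectiveʳ ∘ σ-bidegree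

    basis : Fin (length basisSubsets) → gr.Carrierᴹ
    basis i = z (σ i) , gen (σ i , ℕₚ.≤-reflexive (σ-rank i) , refl) , gen (σ i , σ-size i , refl)

    combination : (Fin (length basisSubsets) → K.Carrier) → gr.Carrierᴹ
    combination a = ∑ λ i → a i gr.*ₗ basis i

    coordinate-combination : ∀ a T →
      coordinate (proj₁ (combination a)) T K.≈ sum (λ i → a i K.* coordinate (z (σ i)) T)
    coordinate-combination a T = K.trans (coordinate-∑ (λ i → a i gr.*ₗ basis i) T)
      (sum-cong-≋ λ i → coeff-· (a i) (z (σ i)) (indicator T))

    coordinate-combination-basis : ∀ a i →
      coordinate (proj₁ (combination a)) (σ i) K.≈ a i
    coordinate-combination-basis a i = K.trans (coordinate-combination a (σ i)) (single a i σ-injective)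
      where
      -- Generalised to any injective family on `Fin m`, so that `m` can be matched as a successor
      -- and the summand at `i` split off.
      single : ∀ {m} {τ : Fin m → Subset k} (a : Fin m → K.Carrier) i → (∀ i j → τ i ≡ τ j → i ≡ j) →
        sum (λ j → a j K.* coordinate (z (τ j)) (τ i)) K.≈ a i
      single {suc m} {τ} a i inj = begin
        sum term                                ≈⟨ sum-remove {i = i} term ⟩
        term i K.+ sum (term ∘ punchIn i)       ≈⟨ K.+-cong (K.*-congˡ (coordinate-z (τ i))) (sum-cong-≋ others) ⟩
        a i K.* K.1# K.+ sum {m} (λ _ → K.0#)   ≈⟨ K.+-cong (K.*-identityʳ (a i)) (sum-replicate-zero m) ⟩
        a i K.+ K.0#                            ≈⟨ K.+-identityʳ (a i) ⟩
        a i                                     ∎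
        where
        term = λ j → a j K.* coordinate (z (τ j)) (τ i)

        others : ∀ j → term (punchIn i j) K.≈ K.0#
        others j = K.trans
          (K.*-congˡ (coordinate-z-≢ (τ (punchIn i j)) (τ i) (Finₚ.punchInᵢ≢i i j ∘ inj _ _)))
          (K.zeroʳ _)

    coordinate-combination-≢ : ∀ a {T} → bidegree G T ≢ p ∷ d ∷ [] →
      coordinate (proj₁ (combination a)) T K.≈ K.0#
    coordinate-combination-≢ a {T} T≢ = begin
      coordinate (proj₁ (combination a)) T   ≈⟨ coordinate-combination a T ⟩
      sum (λ j → a j K.* coordinate (z (σ j)) T)         ≈⟨ sum-cong-≋ (λ j → K.trans
        (K.*-congˡ (coordinate-z-≢ (σ j) T λ { refl → T≢ (σ-bidegree j) })) (K.zeroʳ (a j))) ⟩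
      sum {length basisSubsets} (λ _ → K.0#)             ≈⟨ sum-replicate-zero (length basisSubsets) ⟩
      K.0#                                               ∎

    -- If `T` has bidegree (`p`, `d`), it is some `σ i`. Otherwise both sides are zero: membership
    -- in the filtration kills the coordinate of `v` when the rank exceeds `p`, and homogeneity
    -- kills it when the rank is `p` but the size is not `d`.
    agree-combination : ∀ v → Member (filtration p) v → Member (homogeneous d) v → ∀ T → ¬ rank G T < p →
      coordinate v T K.≈ coordinate (proj₁ (combination λ i → coordinate v (σ i))) T
    agree-combination v v∈F v∈B_d T r≮p = agree (bidegree G T ≟ᴱ (p ∷ d ∷ []))
      where
      a = λ i → coordinate v (σ i)
      w = proj₁ (combination a)

      vanishes : bidegree G T ≢ p ∷ d ∷ [] → Dec (rank G T ≤ p) → coordinate v T K.≈ K.0#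
      vanishes T≢ (no r≰p)  = span⇒coordinate≈0 {v = v} v∈F T r≰p
      vanishes T≢ (yes r≤p) = span⇒coordinate≈0 {v = v} v∈B_d T λ size → T≢
        (cong₂ (λ r s → r ∷ s ∷ []) (ℕₚ.≤-antisym r≤p (ℕₚ.≮⇒≥ r≮p)) size)

      agree : Dec (bidegree G T ≡ p ∷ d ∷ []) → coordinate v T K.≈ coordinate w T
      agree (yes T≡) = ≡.subst (λ S → coordinate v S K.≈ coordinate w S)
        (≡.sym (lookup-index T∈)) (K.sym (coordinate-combination-basis a (index T∈)))
        where T∈ = ∈-filter⁺ (λ S → bidegree G S ≟ᴱ (p ∷ d ∷ [])) (∈-subsets T) T≡
      agree (no T≢)  = K.trans (vanishes T≢ (rank G T ≤? p)) (K.sym (coordinate-combination-≢ a T≢))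

    basis-spans : ∀ v → ∃ λ a → v gr.≈ᴹ combination a
    -- Equality in `gr p d` asks that the difference lie in the previous filtration step, so only
    -- coordinates of rank at least `p` have to agree.
    basis-spans (v , v∈F , v∈B_d) = a , coordinate≈0⇒below p (v P.+ (K.- K.1#) P.· w) λ T r≮p →
      K.trans (coeff-minus v w (indicator T)) (x≈y⇒x∙y⁻¹≈ε (agree-combination v v∈F v∈B_d T r≮p))
      where
      a = λ i → coordinate v (σ i)
      w = proj₁ (combination a)

    basis-independent : ∀ a → combination a gr.≈ᴹ gr.0ᴹ → ∀ i → a i K.≈ K.0#
    basis-independent a ∑≈0 i = begin
      a i                                   ≈⟨ coordinate-combination-basis a i ⟨
      coordinate w (σ i)                    ≈⟨ K.+-identityʳ _ ⟨
      coordinate w (σ i) K.+ K.0#           ≈⟨ coeff-+ w [] (indicator (σ i)) ⟨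
      -- The hypothesis puts `w` minus zero, which computes to `w P.+ []`, in the previous
      -- filtration step, where coordinates of rank exactly `p` vanish.
      coordinate (w P.+ []) (σ i)           ≈⟨ below⇒coordinate≈0 p {w P.+ []} ∑≈0 (σ i) (ℕₚ.<-irrefl (σ-rank i)) ⟩
      K.0#                                  ∎
      where w = proj₁ (combination a)

    gr-dimension : HasDimension (gr p d) (length basisSubsets)
    gr-dimension = basis , basis-spans , basis-independent

  hilbert-isHilbertPolynomial : IsHilbertPolynomial (hilbert G)
  hilbert-isHilbertPolynomial p d = length (basisSubsets p d) , gr-dimension p d , coeff-hilbert G (p ∷ d ∷ [])

proposition9p3 : ∀ {c ℓ₁ ℓ₂ : Level} (𝕜 : HeytingField c ℓ₁ ℓ₂) →
    ∃ λ (H : Poly (Vec ℕ 2)) →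
    EdgeAlgebra.IsHilbertPolynomial 𝕜 C₃ H
    × H ≈ const (+ 1) + const (+ 3) * u * s + const (+ 3) * u ^ 2 * s ^ 2 + u ^ 2 * s ^ 3
    × negami C₃ ⟦ t ∷ x ∷ y ∷ [] ⟧ ≈ t ^ 3 * y ^ 3 * H ⟦ t⁻¹ ∷ x * y⁻¹ ∷ [] ⟧
proposition9p3 𝕜 = hilbert C₃ , EdgeAlgebraBasis.hilbert-isHilbertPolynomial 𝕜 C₃ , hilbert-C₃ , negami-C₃
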